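{- Let $f(x)\in\mathbf{Z}[x]$ be a separable nonconstant polynomial of even degree, and let $C$ be the hyperelliptic curve $y^2=f(x)$. Let $p$ be a good prime for $f(x)$, and assume that $C(\mathbf{F}_p)=\emptyset$. Let $d$ be any squarefree integer that is a nonzero square modulo $p$. Then $C_d$ does not have a nontrivial point over $\mathbf{Q}_p$.
   Context: Squarefree integers may be negative and are nonzero. An odd prime $p$ is good for $f(x)$ if the reduced polynomial $\bar f(x)\in\mathbf{F}_p[x]$ has the same degree as $f(x)$ and has nonzero discriminant. $C(\mathbf{F}_p)$ denotes the set of $\mathbf{F}_p$-points of the smooth projective hyperelliptic curve over $\mathbf{F}_p$ with affine equation $y^2=\bar f(x)$, including points at infinity; since $\deg f$ is even, there are two $\mathbf{F}_p$-points at infinity if the leading coefficient of $\bar f$ is a square in $\mathbf{F}_p$ and none otherwise. $C_d$ denotes the quadratic twist $dy^2=f(x)$. Points of $C_d$ at infinity and affine points $(x,y)$ with $f(x)=0$ are called trivial; thus $C_d$ has a nontrivial point over $\mathbf{Q}_p$ if and only if there exist $x,y\in\mathbf{Q}_p$ with $dy^2=f(x)$ and $f(x)\ne 0$. -}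

module Defs where

open import Algebra.Bundles using (CommutativeRing)
open import Data.Fin.Base as Fin using (Fin; zero; suc; toℕ; punchIn; splitAt)
open import Data.Integer.Base as ℤ using (ℤ; +_)
import Data.Integer.Properties as ℤ-Prop
open import Data.Integer.Divisibility.Signed
  using (_∣_; divides; ∣-trans; ∣m∣n⇒∣m+n; ∣m⇒∣-m; ∣n⇒∣m*n; *-cancelˡ-∣)
open import Data.Integer.Solver using (module +-*-Solver)
open import Data.List.Base using (List; []; _∷_; map)
open import Data.Nat.Base as ℕ using (ℕ; zero; suc)
import Data.Nat.Properties as ℕ-Prop
open import Data.Nat.Primality using (Prime; prime⇒nonZero)
open import Data.Product.Base using (Σ; _×_; _,_; ∃-syntax)
open import Data.Rational.Base as ℚ using (ℚ)
import Data.Rational.Properties as ℚ-Prop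
open import Data.Sum.Base using ([_,_]′)
open import Data.Unit.Base using (⊤)
open import Level using (0ℓ)
open import Relation.Binary.PropositionalEquality as ≡ using (_≡_; _≢_)
open import Relation.Nullary using (¬_; yes; no)
import Relation.Binary.Reasoning.Setoid as SetoidReasoning

Ring : Set₁
Ring = CommutativeRing 0ℓ 0ℓ

ℤ-ring ℚ-ring : Ring
ℤ-ring = ℤ-Prop.+-*-commutativeRing
ℚ-ring = ℚ-Prop.+-*-commutativeRing

------------------------------------------------------------------------
-- Polynomials

module Polynomial (R : Ring) where
  open CommutativeRing R hiding (zero)
  open import Algebra.Definitions.RawMonoid +-rawMonoid
    using () renaming (_×_ to _·_; sum to ∑)
  open import Algebra.Properties.Semiring.Exp semiring using (_^_)

  -- a₀ ∷ a₁ ∷ a₂ ∷ … ; trailing zeros are allowed, so polynomials are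
  -- compared by _≋_ and the degree is not read off from the length.
  Poly : Set
  Poly = List Carrier

  coeff : Poly → ℕ → Carrier
  coeff []      _       = 0#
  coeff (a ∷ f) zero    = a
  coeff (a ∷ f) (suc k) = coeff f k

  infix 4 _≋_

  _≋_ : Poly → Poly → Set
  f ≋ g = ∀ k → coeff f k ≈ coeff g k

  Degree : Poly → ℕ → Set
  Degree f n = ¬ (coeff f n ≈ 0#) × (∀ k → n ℕ.< k → coeff f k ≈ 0#)

  eval : Poly → Carrier → Carrier
  eval []      x = 0#
  eval (a ∷ f) x = a + x * eval f x

  infixl 6 _⊕_
  infixl 7 _⊗_

  _⊕_ : Poly → Poly → Poly
  []      ⊕ g       = g
  (a ∷ f) ⊕ []      = a ∷ f
  (a ∷ f) ⊕ (b ∷ g) = a + b ∷ f ⊕ g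

  _⊗_ : Poly → Poly → Poly
  []      ⊗ g = []
  (a ∷ f) ⊗ g = map (a *_) g ⊕ (0# ∷ f ⊗ g)

  derivative : Poly → Poly
  derivative []      = []
  derivative (a ∷ f) = go 1 f
    where
    go : ℕ → Poly → Poly
    go k []      = []
    go k (b ∷ g) = k · b ∷ go (suc k) g

  Coprime : Poly → Poly → Set
  Coprime f g = ∃[ u ] ∃[ v ] u ⊗ f ⊕ v ⊗ g ≋ (1# ∷ [])

  det : ∀ {N} → (Fin N → Fin N → Carrier) → Carrier
  det {zero}  M = 1#
  det {suc N} M =
    ∑ λ j → (- 1#) ^ toℕ j * (M zero j * det λ r c → M (suc r) (punchIn j c))

  -- The row of length N representing x ^ s · g, for g of formal degree e,
  -- coefficients listed from that of the highest power down, where s is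
  -- such that the coefficient of the highest power of g lands in column i.
  shiftedRow : ∀ {N} → ℕ → Poly → ℕ → Fin N → Carrier
  shiftedRow e g i j with i ℕ-Prop.≤? toℕ j | (toℕ j ℕ.∸ i) ℕ-Prop.≤? e
  ... | yes _ | yes _ = coeff g (e ℕ.∸ (toℕ j ℕ.∸ i))
  ... | _     | _     = 0#

  -- The Sylvester matrix of f (formal degree n = suc m) and f′ (formal
  -- degree m) has first column (a , 0 , … , 0 , n a , 0 , … , 0), a being
  -- the coefficient of xⁿ in f.  Here that column is divided by a, so the
  -- determinant is Res(f , f′) / a, without division in R.
  reducedSylvester : ∀ m → Poly → (i j : Fin (m ℕ.+ suc m)) → Carrier
  reducedSylvester m f i = [ rowf , rowf′ ]′ (splitAt m i)
    where
    rowf : Fin m → Fin (m ℕ.+ suc m) → Carrier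
    rowf r j with toℕ r | toℕ j
    ... | zero | zero = 1#
    ... | _    | _    = shiftedRow (suc m) f (toℕ r) j

    rowf′ : Fin (suc m) → Fin (m ℕ.+ suc m) → Carrier
    rowf′ r j with toℕ r | toℕ j
    ... | zero | zero = suc m · 1#
    ... | _    | _    = shiftedRow m (derivative f) (toℕ r) j

  -- Discriminant of f as a polynomial of degree n ≥ 1:
  -- (-1)^(n(n-1)/2) Res(f , f′) / a.  Constants get discriminant 1.
  disc : ℕ → Poly → Carrier
  disc zero    f = 1#
  disc (suc m) f = (- 1#) ^ ((suc m ℕ.* m) ℕ./ 2) * det (reducedSylvester m f)

------------------------------------------------------------------------
-- Integers modulo m

infix 4 _≡_[mod_]

record _≡_[mod_] (a b m : ℤ) : Set where
  constructor mod-by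
  field difference : m ∣ a ℤ.- b

open _≡_[mod_] public

module _ {m : ℤ} where
  open +-*-Solver using (solve; _:=_; _:+_; _:*_; :-_; _:-_)

  private
    by : ∀ {i j} → i ≡ j → m ∣ i → m ∣ j
    by = ≡.subst (m ∣_)

  mod-reflexive : ∀ {a b} → a ≡ b → a ≡ b [mod m ]
  mod-reflexive {a} ≡.refl = mod-by (divides (+ 0) (ℤ-Prop.+-inverseʳ a))

  mod-sym : ∀ {a b} → a ≡ b [mod m ] → b ≡ a [mod m ]
  mod-sym {a} {b} (mod-by p) = mod-by
    (by (solve 2 (λ a b → :- (a :- b) := b :- a) ≡.refl a b) (∣m⇒∣-m p))

  mod-trans : ∀ {a b c} → a ≡ b [mod m ] → b ≡ c [mod m ] → a ≡ c [mod m ]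
  mod-trans {a} {b} {c} (mod-by p) (mod-by q) = mod-by
    (by (solve 3 (λ a b c → (a :- b) :+ (b :- c) := a :- c) ≡.refl a b c)
        (∣m∣n⇒∣m+n p q))

  mod-+ : ∀ {a b c d} → a ≡ b [mod m ] → c ≡ d [mod m ] →
          a ℤ.+ c ≡ b ℤ.+ d [mod m ]
  mod-+ {a} {b} {c} {d} (mod-by p) (mod-by q) = mod-by
    (by (solve 4 (λ a b c d →
           (a :- b) :+ (c :- d) := (a :+ c) :- (b :+ d)) ≡.refl a b c d)
        (∣m∣n⇒∣m+n p q))

  mod-* : ∀ {a b c d} → a ≡ b [mod m ] → c ≡ d [mod m ] →
          a ℤ.* c ≡ b ℤ.* d [mod m ]
  mod-* {a} {b} {c} {d} (mod-by p) (mod-by q) = mod-by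
    (by (solve 4 (λ a b c d →
           c :* (a :- b) :+ b :* (c :- d) := (a :* c) :- (b :* d)) ≡.refl a b c d)
        (∣m∣n⇒∣m+n (∣n⇒∣m*n c p) (∣n⇒∣m*n b q)))

  mod-neg : ∀ {a b} → a ≡ b [mod m ] → ℤ.- a ≡ ℤ.- b [mod m ]
  mod-neg {a} {b} (mod-by p) = mod-by
    (by (solve 2 (λ a b → :- (a :- b) := (:- a) :- (:- b)) ≡.refl a b)
        (∣m⇒∣-m p))

ℤ/ : ℤ → Ring
ℤ/ m = record
  { Carrier = ℤ
  ; _≈_ = _≡_[mod m ]
  ; _+_ = ℤ._+_
  ; _*_ = ℤ._*_
  ; -_  = ℤ.-_
  ; 0#  = + 0
  ; 1#  = + 1
  ; isCommutativeRing = record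
    { isRing = record
      { +-isAbelianGroup = record
        { isGroup = record
          { isMonoid = record
            { isSemigroup = record
              { isMagma = record
                { isEquivalence = record
                  { refl  = mod-reflexive ≡.refl
                  ; sym   = mod-sym
                  ; trans = mod-trans
                  }
                ; ∙-cong = mod-+
                }
              ; assoc = λ a b c → mod-reflexive (ℤ-Prop.+-assoc a b c)
              }
            ; identity = (λ a → mod-reflexive (ℤ-Prop.+-identityˡ a))
                       , (λ a → mod-reflexive (ℤ-Prop.+-identityʳ a))
            }
          ; inverse = (λ a → mod-reflexive (ℤ-Prop.+-inverseˡ a))
                    , (λ a → mod-reflexive (ℤ-Prop.+-inverseʳ a))
          ; ⁻¹-cong = mod-neg
          }
        ; comm = λ a b → mod-reflexive (ℤ-Prop.+-comm a b)
        }
      ; *-cong = mod-*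
      ; *-assoc = λ a b c → mod-reflexive (ℤ-Prop.*-assoc a b c)
      ; *-identity = (λ a → mod-reflexive (ℤ-Prop.*-identityˡ a))
                   , (λ a → mod-reflexive (ℤ-Prop.*-identityʳ a))
      ; distrib = (λ a b c → mod-reflexive (ℤ-Prop.*-distribˡ-+ a b c))
                , (λ a b c → mod-reflexive (ℤ-Prop.*-distribʳ-+ a b c))
      }
    ; *-comm = λ a b → mod-reflexive (ℤ-Prop.*-comm a b)
    }
  }

𝔽 : ℕ → Ring
𝔽 p = ℤ/ (+ p)

------------------------------------------------------------------------
-- p-adic integers: the inverse limit of the rings ℤ/pⁿ

module PAdicIntegers (p : ℕ) .{{_ : ℕ.NonZero p}} where

  infix 8 p^_

  p^_ : ℕ → ℤ
  p^ n = (+ p) ℤ.^ n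

  record Carrier : Set where
    constructor _coherently_
    field
      residue  : ℕ → ℤ
      coherent : ∀ n → residue (suc n) ≡ residue n [mod p^ n ]

  open Carrier public

  infix 4 _≈_

  record _≈_ (x y : Carrier) : Set where
    constructor pointwise
    field at : ∀ n → residue x n ≡ residue y n [mod p^ n ]

  open _≈_ public

  const : ℤ → Carrier
  const a = (λ _ → a) coherently λ _ → mod-reflexive ≡.refl

  _+_ _*_ : Carrier → Carrier → Carrier
  x + y = (λ n → residue x n ℤ.+ residue y n)
    coherently λ n → mod-+ (coherent x n) (coherent y n)
  x * y = (λ n → residue x n ℤ.* residue y n)
    coherently λ n → mod-* (coherent x n) (coherent y n)

  -_ : Carrier → Carrier
  - x = (λ n → ℤ.- residue x n) coherently λ n → mod-neg (coherent x n)

  private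
    strictly : ∀ {x y} → (∀ n → residue x n ≡ residue y n) → x ≈ y
    strictly e = pointwise λ n → mod-reflexive (e n)

  ring : Ring
  ring = record
    { Carrier = Carrier
    ; _≈_ = _≈_
    ; _+_ = _+_
    ; _*_ = _*_
    ; -_  = -_
    ; 0#  = const (+ 0)
    ; 1#  = const (+ 1)
    ; isCommutativeRing = record
      { isRing = record
        { +-isAbelianGroup = record
          { isGroup = record
            { isMonoid = record
              { isSemigroup = record
                { isMagma = record
                  { isEquivalence = record
                    { refl  = strictly λ _ → ≡.refl
                    ; sym   = λ e → pointwise λ n → mod-sym (at e n)
                    ; trans = λ e f → pointwise λ n → mod-trans (at e n) (at f n)
                    }
                  ; ∙-cong = λ e f → pointwise λ n → mod-+ (at e n) (at f n)
                  }
                ; assoc = λ x y z → strictly λ n →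
                    ℤ-Prop.+-assoc (residue x n) (residue y n) (residue z n)
                }
              ; identity = (λ x → strictly λ n → ℤ-Prop.+-identityˡ (residue x n))
                         , (λ x → strictly λ n → ℤ-Prop.+-identityʳ (residue x n))
              }
            ; inverse = (λ x → strictly λ n → ℤ-Prop.+-inverseˡ (residue x n))
                      , (λ x → strictly λ n → ℤ-Prop.+-inverseʳ (residue x n))
            ; ⁻¹-cong = λ e → pointwise λ n → mod-neg (at e n)
            }
          ; comm = λ x y → strictly λ n →
              ℤ-Prop.+-comm (residue x n) (residue y n)
          }
        ; *-cong = λ e f → pointwise λ n → mod-* (at e n) (at f n)
        ; *-assoc = λ x y z → strictly λ n →
            ℤ-Prop.*-assoc (residue x n) (residue y n) (residue z n)
        ; *-identity = (λ x → strictly λ n → ℤ-Prop.*-identityˡ (residue x n))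
                     , (λ x → strictly λ n → ℤ-Prop.*-identityʳ (residue x n))
        ; distrib = (λ x y z → strictly λ n →
                       ℤ-Prop.*-distribˡ-+ (residue x n) (residue y n) (residue z n))
                  , (λ x y z → strictly λ n →
                       ℤ-Prop.*-distribʳ-+ (residue x n) (residue y n) (residue z n))
        }
      ; *-comm = λ x y → strictly λ n → ℤ-Prop.*-comm (residue x n) (residue y n)
      }
    }

  p-cancel : ∀ {x y} → const (+ p) * x ≈ const (+ p) * y → x ≈ y
  p-cancel {x} {y} e = pointwise λ n →
    mod-trans (mod-sym (coherent x n)) (mod-trans (cancel n) (coherent y n))
    where
    open +-*-Solver using (solve; _:=_; _:*_; _:-_)

    cancel : ∀ n → residue x (suc n) ≡ residue y (suc n) [mod p^ n ]
    cancel n = mod-by (*-cancelˡ-∣ (+ p)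
      (≡.subst (p^ (suc n) ∣_)
        (solve 3 (λ q a b → q :* a :- q :* b := q :* (a :- b)) ≡.refl
          (+ p) (residue x (suc n)) (residue y (suc n)))
        (difference (at e (suc n)))))

------------------------------------------------------------------------
-- R[1/π], for a non-zero-divisor π of R

module Localization
  (R : Ring)
  (π : CommutativeRing.Carrier R)
  (π-cancel : ∀ {x y} → CommutativeRing._≈_ R (CommutativeRing._*_ R π x)
                                              (CommutativeRing._*_ R π y)
                      → CommutativeRing._≈_ R x y)
  where

  private
    module R = CommutativeRing R

  open import Algebra.Properties.Semiring.Exp R.semiring
    using (_^_; ^-homo-*)
  open import Algebra.Properties.Ring R.ring using (-‿distribʳ-*)
  open import Algebra.Solver.Ring.NaturalCoefficients.Default R.commutativeSemiring
    using (solve; _:=_; _:+_; _:*_)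
  open SetoidReasoning R.setoid

  infix 5 _/π^_

  record Carrier : Set where
    constructor _/π^_
    field
      num : R.Carrier
      exp : ℕ

  infix 4 _≈_

  record _≈_ (x y : Carrier) : Set where
    constructor cross
    open Carrier
    field
      crossed : π ^ exp y R.* num x R.≈ π ^ exp x R.* num y

  fromR : R.Carrier → Carrier
  fromR a = a /π^ 0

  infixl 6 _+_
  infixl 7 _*_
  infix  8 -_

  _+_ _*_ : Carrier → Carrier → Carrier
  (a /π^ k) + (b /π^ l) = π ^ l R.* a R.+ π ^ k R.* b /π^ k ℕ.+ l
  (a /π^ k) * (b /π^ l) = a R.* b /π^ k ℕ.+ l

  -_ : Carrier → Carrier
  - (a /π^ k) = R.- a /π^ k

  private
    π^-cancel : ∀ k {x y} → π ^ k R.* x R.≈ π ^ k R.* y → x R.≈ y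
    π^-cancel zero    {x} {y} e =
      R.trans (R.sym (R.*-identityˡ x)) (R.trans e (R.*-identityˡ y))
    π^-cancel (suc k) {x} {y} e = π^-cancel k (π-cancel (R.trans
      (R.sym (R.*-assoc π (π ^ k) x)) (R.trans e (R.*-assoc π (π ^ k) y))))

    hom : ∀ k l → π ^ (k ℕ.+ l) R.≈ π ^ k R.* π ^ l
    hom = ^-homo-* π

    hom₃ʳ : ∀ k l m → π ^ (k ℕ.+ (l ℕ.+ m)) R.≈ π ^ k R.* (π ^ l R.* π ^ m)
    hom₃ʳ k l m = R.trans (hom k (l ℕ.+ m)) (R.*-congˡ (hom l m))

    ≈-refl : ∀ {x} → x ≈ x
    ≈-refl = cross R.refl

    ≈-sym : ∀ {x y} → x ≈ y → y ≈ x
    ≈-sym (cross e) = cross (R.sym e)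

    swap : ∀ u v a → u R.* (v R.* a) R.≈ v R.* (u R.* a)
    swap = solve 3 (λ u v a →
      u :* (v :* a) :=
      v :* (u :* a)) R.refl

    ≈-trans : ∀ {x y z} → x ≈ y → y ≈ z → x ≈ z
    ≈-trans {a /π^ k} {b /π^ l} {c /π^ m} (cross e) (cross f) =
      cross (π^-cancel l (begin
        π ^ l R.* (π ^ m R.* a)  ≈⟨ swap _ _ _ ⟩
        π ^ m R.* (π ^ l R.* a)  ≈⟨ R.*-congˡ e ⟩
        π ^ m R.* (π ^ k R.* b)  ≈⟨ swap _ _ _ ⟩
        π ^ k R.* (π ^ m R.* b)  ≈⟨ R.*-congˡ f ⟩
        π ^ k R.* (π ^ l R.* c)  ≈⟨ swap _ _ _ ⟩
        π ^ l R.* (π ^ k R.* c)  ∎))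

    -- equal numerators and exponents
    same : ∀ {a b k l} → a R.≈ b → k ≡ l → (a /π^ k) ≈ (b /π^ l)
    same e ≡.refl = cross (R.*-congˡ e)

    +-cong : ∀ {x y u v} → x ≈ y → u ≈ v → x + u ≈ y + v
    +-cong {a /π^ k} {b /π^ l} {c /π^ m} {d /π^ n} (cross e) (cross f) =
      cross (begin
        π ^ (l ℕ.+ n) R.* (π ^ m R.* a R.+ π ^ k R.* c)
          ≈⟨ R.*-congʳ (hom l n) ⟩
        π ^ l R.* π ^ n R.* (π ^ m R.* a R.+ π ^ k R.* c)
          ≈⟨ expand _ _ _ _ _ _ ⟩
        π ^ n R.* π ^ m R.* (π ^ l R.* a) R.+ π ^ l R.* π ^ k R.* (π ^ n R.* c)
          ≈⟨ R.+-cong (R.*-congˡ e) (R.*-congˡ f) ⟩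
        π ^ n R.* π ^ m R.* (π ^ k R.* b) R.+ π ^ l R.* π ^ k R.* (π ^ m R.* d)
          ≈⟨ collect _ _ _ _ _ _ ⟩
        π ^ k R.* π ^ m R.* (π ^ n R.* b R.+ π ^ l R.* d)
          ≈⟨ R.*-congʳ (hom k m) ⟨
        π ^ (k ℕ.+ m) R.* (π ^ n R.* b R.+ π ^ l R.* d) ∎)
      where
      expand : ∀ L N M K a c →
        L R.* N R.* (M R.* a R.+ K R.* c) R.≈
        N R.* M R.* (L R.* a) R.+ L R.* K R.* (N R.* c)
      expand = solve 6 (λ L N M K a c →
        L :* N :* (M :* a :+ K :* c) :=
        N :* M :* (L :* a) :+ L :* K :* (N :* c)) R.refl
      collect : ∀ L N M K b d →
        N R.* M R.* (K R.* b) R.+ L R.* K R.* (M R.* d) R.≈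
        K R.* M R.* (N R.* b R.+ L R.* d)
      collect = solve 6 (λ L N M K b d →
        N :* M :* (K :* b) :+ L :* K :* (M :* d) :=
        K :* M :* (N :* b :+ L :* d)) R.refl

    *-cong : ∀ {x y u v} → x ≈ y → u ≈ v → x * u ≈ y * v
    *-cong {a /π^ k} {b /π^ l} {c /π^ m} {d /π^ n} (cross e) (cross f) =
      cross (begin
        π ^ (l ℕ.+ n) R.* (a R.* c)          ≈⟨ R.*-congʳ (hom l n) ⟩
        π ^ l R.* π ^ n R.* (a R.* c)        ≈⟨ interchange _ _ _ _ ⟩
        π ^ l R.* a R.* (π ^ n R.* c)        ≈⟨ R.*-cong e f ⟩
        π ^ k R.* b R.* (π ^ m R.* d)        ≈⟨ interchange _ _ _ _ ⟨
        π ^ k R.* π ^ m R.* (b R.* d)        ≈⟨ R.*-congʳ (hom k m) ⟨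
        π ^ (k ℕ.+ m) R.* (b R.* d)          ∎)
      where
      interchange : ∀ L N a c →
        L R.* N R.* (a R.* c) R.≈ L R.* a R.* (N R.* c)
      interchange = solve 4 (λ L N a c →
        L :* N :* (a :* c) :=
        L :* a :* (N :* c)) R.refl

    neg-cong : ∀ {x y} → x ≈ y → - x ≈ - y
    neg-cong {a /π^ k} {b /π^ l} (cross e) = cross (begin
      π ^ l R.* (R.- a)    ≈⟨ -‿distribʳ-* _ _ ⟨
      R.- (π ^ l R.* a)    ≈⟨ R.-‿cong e ⟩
      R.- (π ^ k R.* b)    ≈⟨ -‿distribʳ-* _ _ ⟩
      π ^ k R.* (R.- b)    ∎)

    +-comm : ∀ x y → x + y ≈ y + x
    +-comm (a /π^ k) (b /π^ l) = same (R.+-comm _ _) (ℕ-Prop.+-comm k l)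

    +-assoc : ∀ x y z → (x + y) + z ≈ x + (y + z)
    +-assoc (a /π^ k) (b /π^ l) (c /π^ m) = same (begin
      π ^ m R.* (π ^ l R.* a R.+ π ^ k R.* b) R.+ π ^ (k ℕ.+ l) R.* c
        ≈⟨ R.+-congˡ (R.*-congʳ (hom k l)) ⟩
      π ^ m R.* (π ^ l R.* a R.+ π ^ k R.* b) R.+ π ^ k R.* π ^ l R.* c
        ≈⟨ rearrange _ _ _ _ _ _ ⟩
      π ^ l R.* π ^ m R.* a R.+ π ^ k R.* (π ^ m R.* b R.+ π ^ l R.* c)
        ≈⟨ R.+-congʳ (R.*-congʳ (hom l m)) ⟨
      π ^ (l ℕ.+ m) R.* a R.+ π ^ k R.* (π ^ m R.* b R.+ π ^ l R.* c) ∎)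
      (ℕ-Prop.+-assoc k l m)
      where
      rearrange : ∀ K L M a b c →
        M R.* (L R.* a R.+ K R.* b) R.+ K R.* L R.* c R.≈
        L R.* M R.* a R.+ K R.* (M R.* b R.+ L R.* c)
      rearrange = solve 6 (λ K L M a b c →
        M :* (L :* a :+ K :* b) :+ K :* L :* c :=
        L :* M :* a :+ K :* (M :* b :+ L :* c)) R.refl

    +-identityˡ : ∀ x → fromR R.0# + x ≈ x
    +-identityˡ (a /π^ k) = same (begin
      π ^ k R.* R.0# R.+ R.1# R.* a  ≈⟨ R.+-cong (R.zeroʳ _) (R.*-identityˡ a) ⟩
      R.0# R.+ a                     ≈⟨ R.+-identityˡ a ⟩
      a                              ∎) ≡.refl

    +-inverseˡ : ∀ x → - x + x ≈ fromR R.0#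
    +-inverseˡ (a /π^ k) = cross (begin
      R.1# R.* (π ^ k R.* (R.- a) R.+ π ^ k R.* a)
        ≈⟨ R.*-identityˡ _ ⟩
      π ^ k R.* (R.- a) R.+ π ^ k R.* a
        ≈⟨ R.distribˡ _ _ _ ⟨
      π ^ k R.* (R.- a R.+ a)
        ≈⟨ R.*-congˡ (R.-‿inverseˡ a) ⟩
      π ^ k R.* R.0#
        ≈⟨ R.trans (R.zeroʳ _) (R.sym (R.zeroʳ _)) ⟩
      π ^ (k ℕ.+ k) R.* R.0# ∎)

    *-comm : ∀ x y → x * y ≈ y * x
    *-comm (a /π^ k) (b /π^ l) = same (R.*-comm a b) (ℕ-Prop.+-comm k l)

    *-assoc : ∀ x y z → (x * y) * z ≈ x * (y * z)
    *-assoc (a /π^ k) (b /π^ l) (c /π^ m) =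
      same (R.*-assoc a b c) (ℕ-Prop.+-assoc k l m)

    *-identityˡ : ∀ x → fromR R.1# * x ≈ x
    *-identityˡ (a /π^ k) = same (R.*-identityˡ a) ≡.refl

    distribˡ : ∀ x y z → x * (y + z) ≈ x * y + x * z
    distribˡ (a /π^ k) (b /π^ l) (c /π^ m) = cross (begin
      π ^ (k ℕ.+ l ℕ.+ (k ℕ.+ m)) R.* (a R.* (π ^ m R.* b R.+ π ^ l R.* c))
        ≈⟨ R.*-congʳ (R.trans (hom (k ℕ.+ l) (k ℕ.+ m))
                              (R.*-cong (hom k l) (hom k m))) ⟩
      π ^ k R.* π ^ l R.* (π ^ k R.* π ^ m)
        R.* (a R.* (π ^ m R.* b R.+ π ^ l R.* c))
        ≈⟨ rearrange _ _ _ _ _ _ ⟩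
      π ^ k R.* (π ^ l R.* π ^ m)
        R.* (π ^ k R.* π ^ m R.* (a R.* b) R.+ π ^ k R.* π ^ l R.* (a R.* c))
        ≈⟨ R.*-cong (hom₃ʳ k l m)
             (R.+-cong (R.*-congʳ (hom k m)) (R.*-congʳ (hom k l))) ⟨
      π ^ (k ℕ.+ (l ℕ.+ m))
        R.* (π ^ (k ℕ.+ m) R.* (a R.* b) R.+ π ^ (k ℕ.+ l) R.* (a R.* c)) ∎)
      where
      rearrange : ∀ K L M a b c →
        K R.* L R.* (K R.* M) R.* (a R.* (M R.* b R.+ L R.* c)) R.≈
        K R.* (L R.* M) R.* (K R.* M R.* (a R.* b) R.+ K R.* L R.* (a R.* c))
      rearrange = solve 6 (λ K L M a b c →
        K :* L :* (K :* M) :* (a :* (M :* b :+ L :* c)) :=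
        K :* (L :* M) :* (K :* M :* (a :* b) :+ K :* L :* (a :* c))) R.refl

  ring : Ring
  ring = record
    { Carrier = Carrier
    ; _≈_ = _≈_
    ; _+_ = _+_
    ; _*_ = _*_
    ; -_  = -_
    ; 0#  = fromR R.0#
    ; 1#  = fromR R.1#
    ; isCommutativeRing = record
      { isRing = record
        { +-isAbelianGroup = record
          { isGroup = record
            { isMonoid = record
              { isSemigroup = record
                { isMagma = record
                  { isEquivalence = record
                    { refl = ≈-refl ; sym = ≈-sym ; trans = ≈-trans }
                  ; ∙-cong = +-cong
                  }
                ; assoc = +-assoc
                }
              ; identity = +-identityˡ
                         , λ x → ≈-trans (+-comm x _) (+-identityˡ x)
              }
            ; inverse = +-inverseˡ
                      , λ x → ≈-trans (+-comm x _) (+-inverseˡ x)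
            ; ⁻¹-cong = neg-cong
            }
          ; comm = +-comm
          }
        ; *-cong = *-cong
        ; *-assoc = *-assoc
        ; *-identity = *-identityˡ
                     , λ x → ≈-trans (*-comm x _) (*-identityˡ x)
        ; distrib = distribˡ
                  , λ x y z → ≈-trans (*-comm (y + z) x)
                      (≈-trans (distribˡ x y z)
                        (+-cong (*-comm x y) (*-comm x z)))
        }
      ; *-comm = *-comm
      }
    }

------------------------------------------------------------------------
-- The field of p-adic numbers ℤ_p[1/p]

module PAdicNumbers (p : ℕ) .{{_ : ℕ.NonZero p}} where
  private module ℤ-adic = PAdicIntegers p

  open Localization ℤ-adic.ring (ℤ-adic.const (+ p)) ℤ-adic.p-cancel public

  fromℤ : ℤ → Carrier
  fromℤ a = fromR (ℤ-adic.const a)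

------------------------------------------------------------------------
-- Hyperelliptic curves of even degree

-- K-points of the smooth projective model of e y² = f(x), where K is a
-- field, e ≠ 0, and f has even degree n and nonzero discriminant.  Near
-- infinity, put t = 1/x and w = y/x^(n/2): the equation becomes
-- e w² = tⁿ f(1/t), so the points at infinity (t = 0) are the w with e w²
-- equal to the leading coefficient of f.  Points are not identified up to
-- the equality of K.
module Hyperelliptic (K : Ring) where
  open CommutativeRing K
  open Polynomial K

  data Point (e : Carrier) (f : Poly) (n : ℕ) : Set where
    affine   : ∀ x y → e * (y * y) ≈ eval f x → Point e f n
    infinity : ∀ w → e * (w * w) ≈ coeff f n → Point e f n

  Trivial : ∀ {e f n} → Point e f n → Set
  Trivial         (infinity _ _) = ⊤
  Trivial {f = f} (affine x _ _) = eval f x ≈ 0#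

------------------------------------------------------------------------
-- Integer polynomials, their reductions and their curves

open Polynomial using (Poly; Degree; Coprime; derivative; disc) public

ℤ[X] : Set
ℤ[X] = Poly ℤ-ring

Separable : ℤ[X] → Set
Separable f = Coprime ℚ-ring fℚ (derivative ℚ-ring fℚ)
  where
  fℚ : Poly ℚ-ring
  fℚ = map (λ a → a ℚ./ 1) f

-- 𝔽 p is ℤ with a coarser equality, so the coefficients do not change.
reduce : ∀ p → ℤ[X] → Poly (𝔽 p)
reduce p f = f

record GoodPrime (f : ℤ[X]) (p : ℕ) : Set where
  open CommutativeRing (𝔽 p) using (_≈_; 0#)
  field
    isPrime        : Prime p
    isOdd          : p ≢ 2
    degree         : ℕ
    degree-f       : Degree ℤ-ring f degree
    degree-reduced : Degree (𝔽 p) (reduce p f) degree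
    disc-reduced   : ¬ (disc (𝔽 p) degree (reduce p f) ≈ 0#)

-- Nonzero, since 2² ∣ 0.
Squarefree : ℤ → Set
Squarefree d = ∀ k → k ℤ.* k ∣ d → ℤ.∣ k ∣ ≡ 1

NonzeroSquareMod : ℕ → ℤ → Set
NonzeroSquareMod p d = ¬ (d ≈ 0#) × ∃[ s ] s * s ≈ d
  where open CommutativeRing (𝔽 p)

-- C(𝔽_p), for C : y² = f(x) with f of even degree n.
C⟨𝔽_⟩ : ∀ p → ℤ[X] → ℕ → Set
C⟨𝔽 p ⟩ f n = Point 1# (reduce p f) n
  where
  open CommutativeRing (𝔽 p) using (1#)
  open Hyperelliptic (𝔽 p)

module _ (p : ℕ) .{{_ : ℕ.NonZero p}} where
  open PAdicNumbers p
  open Hyperelliptic ring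

  -- C_d(ℚ_p), for C_d : d y² = f(x) with f of even degree n.
  TwistPoint : ℤ → ℤ[X] → ℕ → Set
  TwistPoint d f n = Point (fromℤ d) (map fromℤ f) n

  HasNontrivialPoint : ℤ → ℤ[X] → ℕ → Set
  HasNontrivialPoint d f n = Σ (TwistPoint d f n) λ P → ¬ Trivial P

{-# OPTIONS --safe #-}

-- Write a point of C_d over ℚ_p as (a / pᵏ , b / pˡ) and clear denominators:
-- d b² pᵏᴸ = p²ˡ H (a , pᵏ), where H is f made homogeneous of degree L.  Only
-- residues modulo a fixed power of p matter.  Powers of p dividing both a and pᵏ
-- can be cancelled, until k = 0 or p does not divide a; as p does not divide d,
-- what remains of p²ˡ then divides b² and can be cancelled too.  Multiplying b
-- by a square root of d modulo p yields a point of C over 𝔽_p: the affine point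
-- (a , b) when k = 0, a point at infinity when p does not divide a.

module Submission where

open import Defs

open import Algebra.Bundles using (CommutativeRing)
open import Data.Integer.Base using (ℤ; +_; -[1+_]; _+_; _*_; -_; _^_; ∣_∣)
open import Data.Integer.Divisibility.Signed
  using (divides; _∣?_; ∣-trans; ∣⇒∣ᵤ; ∣ᵤ⇒∣; ∣m⇒∣m*n; *-cancelˡ-∣)
  renaming (_∣_ to _∣ℤ_)
open import Data.Integer.Properties as ℤ-Prop
  using (pos-*; abs-*; *-assoc; *-comm; *-identityˡ; *-zeroʳ; ^-distribˡ-+-*; ^-*-assoc)
open import Data.Integer.Solver using (module +-*-Solver)
open import Data.List.Base using (List; []; _∷_; length; map)
open import Data.Nat.Base as ℕ using (ℕ; zero; suc; s≤s; z≤n)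
open import Data.Nat.Coprimality using (coprime-Bézout)
open import Data.Nat.Divisibility using (_∣_; divides)
open import Data.Nat.GCD using (module Bézout)
open import Data.Nat.Primality
  using (Prime; prime⇒nonZero; prime⇒irreducible; euclidsLemma)
import Data.Nat.Properties as ℕ-Prop
import Data.Nat.Solver as ℕ-Solver
open import Data.Product.Base using (Σ; _×_; _,_; ∃-syntax; map₂; uncurry)
open import Data.Sum.Base using (_⊎_; inj₁; inj₂; [_,_]′)
open import Function.Base using (_∘_; id)
open import Relation.Binary.PropositionalEquality
  using (_≡_; _≢_; refl; sym; trans; cong; cong₂; subst; module ≡-Reasoning)
import Relation.Binary.Reasoning.Setoid as SetoidReasoning
open import Relation.Nullary using (¬_; yes; no; contradiction)

open +-*-Solver using (solve; con; _:=_; _:+_; _:*_; :-_; _:-_)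
open ℕ-Solver.+-*-Solver using ()
  renaming (solve to ℕ-solve; con to ℕ-con; _:=_ to _ℕ-=_; _:+_ to _ℕ-+_; _:*_ to _ℕ-*_)

mod-cast : ∀ {a a′ b b′ m m′} → a ≡ a′ → b ≡ b′ → m ≡ m′ →
           a ≡ b [mod m ] → a′ ≡ b′ [mod m′ ]
mod-cast refl refl refl e = e

mod-weaken : ∀ {a b m m′} → m ∣ℤ m′ → a ≡ b [mod m′ ] → a ≡ b [mod m ]
mod-weaken m∣m′ (mod-by q) = mod-by (∣-trans m∣m′ q)

mod-+multiple : ∀ {m} a t → a + m * t ≡ a [mod m ]
mod-+multiple {m} a t = mod-by (divides t
  (solve 3 (λ m a t → (a :+ m :* t) :- a := t :* m) refl m a t))

mod-0⇒∣ : ∀ {a m} → a ≡ + 0 [mod m ] → m ∣ℤ a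
mod-0⇒∣ {a} (mod-by q) = subst (_ ∣ℤ_) (ℤ-Prop.+-identityʳ a) q

∣⇒mod-0 : ∀ {a m} → m ∣ℤ a → a ≡ + 0 [mod m ]
∣⇒mod-0 {a} q = mod-by (subst (_ ∣ℤ_) (sym (ℤ-Prop.+-identityʳ a)) q)

^-distribʳ-* : ∀ a b n → (a * b) ^ n ≡ a ^ n * b ^ n
^-distribʳ-* a b zero    = refl
^-distribʳ-* a b (suc n) = trans (cong (a * b *_) (^-distribʳ-* a b n))
  (solve 4 (λ a b x y → a :* b :* (x :* y) := a :* x :* (b :* y)) refl
    a b (a ^ n) (b ^ n))

mod-^ : ∀ {a b m} n → a ≡ b [mod m ] → a ^ n ≡ b ^ n [mod m ]
mod-^ zero    e = mod-reflexive refl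
mod-^ (suc n) e = mod-* e (mod-^ n e)

extract-square : ∀ d a b → d * (a * b * (a * b)) ≡ b ^ 2 * (d * (a * a))
extract-square = solve 3 (λ d a b →
  d :* (a :* b :* (a :* b)) := b :* (b :* con (+ 1)) :* (d :* (a :* a))) refl

absorb-square : ∀ a d b → a * a * (d * (b * b)) ≡ d * (a * b * (a * b))
absorb-square = solve 3 (λ a d b →
  a :* a :* (d :* (b :* b)) := d :* (a :* b :* (a :* b))) refl

*-swap : ∀ a b c → a * (b * c) ≡ b * (a * c)
*-swap = solve 3 (λ a b c → a :* (b :* c) := b :* (a :* c)) refl

-- ∑ cᵢ Aⁱ Pᴸ⁻ⁱ with L the length of f, which may exceed deg f + 1.
homogenize : ℤ[X] → ℤ → ℤ → ℤ
homogenize []      A P = + 0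
homogenize (c ∷ f) A P = P ^ length (c ∷ f) * c + A * homogenize f A P

homogenize-scale : ∀ f u A P →
  homogenize f (u * A) (u * P) ≡ u ^ length f * homogenize f A P
homogenize-scale []      u A P = refl
homogenize-scale (c ∷ f) u A P = begin
  (u * P) ^ suc L * c + u * A * homogenize f (u * A) (u * P)
    ≡⟨ cong₂ (λ x y → x * c + u * A * y)
         (^-distribʳ-* u P (suc L)) (homogenize-scale f u A P) ⟩
  u * u ^ L * (P * P ^ L) * c + u * A * (u ^ L * homogenize f A P)
    ≡⟨ solve 7 (λ u v P Q c A h → u :* v :* (P :* Q) :* c :+ u :* A :* (v :* h)
                  := u :* v :* (P :* Q :* c :+ A :* h)) refl
         u (u ^ L) P (P ^ L) c A (homogenize f A P) ⟩
  u ^ suc L * homogenize (c ∷ f) A P ∎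
  where
  open ≡-Reasoning
  L = length f

homogenize-1 : ∀ m f A → homogenize f A (+ 1) ≡ Polynomial.eval (ℤ/ m) f A
homogenize-1 m []      A = refl
homogenize-1 m (c ∷ f) A = cong₂ _+_
  (trans (cong (_* c) (ℤ-Prop.^-zeroˡ (suc (length f)))) (*-identityˡ c))
  (cong (A *_) (homogenize-1 m f A))

coeff-ℤ/ : ∀ m f k → Polynomial.coeff (ℤ/ m) f k ≡ Polynomial.coeff ℤ-ring f k
coeff-ℤ/ m []      k       = refl
coeff-ℤ/ m (c ∷ f) zero    = refl
coeff-ℤ/ m (c ∷ f) (suc k) = coeff-ℤ/ m f k

homogenize-zero : ∀ f → (∀ k → Polynomial.coeff ℤ-ring f k ≡ + 0) →
                  ∀ A P → homogenize f A P ≡ + 0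
homogenize-zero []      z A P = refl
homogenize-zero (c ∷ f) z A P = begin
  P ^ length (c ∷ f) * c + A * homogenize f A P
    ≡⟨ cong₂ (λ x y → P ^ length (c ∷ f) * x + A * y)
         (z 0) (homogenize-zero f (z ∘ suc) A P) ⟩
  P ^ length (c ∷ f) * + 0 + A * + 0
    ≡⟨ cong₂ _+_ (*-zeroʳ (P ^ length (c ∷ f))) (*-zeroʳ A) ⟩
  + 0 ∎
  where open ≡-Reasoning

homogenize-leading : ∀ f n → Degree ℤ-ring f n → ∀ A P →
  ∃[ e ] ∃[ t ] length f ≡ e ℕ.+ n ×
    homogenize f A P ≡ P ^ e * (Polynomial.coeff ℤ-ring f n * A ^ n + P * t)
homogenize-leading []      n       (c≢0 , _)  A P = contradiction refl c≢0
homogenize-leading (c ∷ f) zero    (_ , above) A P =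
  suc (length f) , + 0 , sym (ℕ-Prop.+-identityʳ _) , (begin
    Q * c + A * homogenize f A P
      ≡⟨ cong (λ h → Q * c + A * h)
           (homogenize-zero f (λ k → above (suc k) (s≤s z≤n)) A P) ⟩
    Q * c + A * + 0
      ≡⟨ solve 4 (λ Q c A P → Q :* c :+ A :* con (+ 0)
           := Q :* (c :* con (+ 1) :+ P :* con (+ 0))) refl Q c A P ⟩
    Q * (c * + 1 + P * + 0) ∎)
  where
  open ≡-Reasoning
  Q = P ^ length (c ∷ f)
homogenize-leading (c ∷ f) (suc n) (c≢0 , above) A P
  with homogenize-leading f n (c≢0 , λ k → above (suc k) ∘ s≤s) A P
... | e , t , L≡e+n , h≡ = e , P ^ n * c + A * t
    , trans (cong suc L≡e+n) (sym (ℕ-Prop.+-suc e n)) , (begin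
  P ^ suc (length f) * c + A * homogenize f A P
    ≡⟨ cong₂ (λ L h → P * L * c + A * h)
         (trans (cong (P ^_) L≡e+n) (^-distribˡ-+-* P e n)) h≡ ⟩
  P * (P ^ e * P ^ n) * c + A * (P ^ e * (a * A ^ n + P * t))
    ≡⟨ solve 8 (λ P E N c A a M t →
         P :* (E :* N) :* c :+ A :* (E :* (a :* M :+ P :* t)) :=
         E :* (a :* (A :* M) :+ P :* (N :* c :+ A :* t))) refl
         P (P ^ e) (P ^ n) c A a (A ^ n) t ⟩
  P ^ e * (a * A ^ suc n + P * (P ^ n * c + A * t)) ∎)
  where
  open ≡-Reasoning
  a = Polynomial.coeff ℤ-ring f n

module _ (R : Ring) (π : CommutativeRing.Carrier R)
         {A : Set} (ι : A → CommutativeRing.Carrier R) where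

  private
    module R = CommutativeRing R

  open import Algebra.Properties.Semiring.Exp R.semiring
    using (^-congʳ) renaming (_^_ to _^ᴿ_)

  -- πᴸᵏ f (a / πᵏ), with L the length of f.
  clearedEval : List A → R.Carrier → ℕ → R.Carrier
  clearedEval []      a k = R.0#
  clearedEval (c ∷ f) a k = π ^ᴿ (length (c ∷ f) ℕ.* k) R.* ι c R.+ a R.* clearedEval f a k

  ClearedSolution : A → List A → Set
  ClearedSolution d f = ∃[ a ] ∃[ k ] ∃[ b ] ∃[ l ]
    π ^ᴿ (length f ℕ.* k) R.* (ι d R.* (b R.* b)) R.≈ π ^ᴿ (l ℕ.+ l) R.* clearedEval f a k

  module _ (π-cancel : ∀ {x y} → π R.* x R.≈ π R.* y → x R.≈ y) where

    open Localization R π π-cancel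
      using (cross; fromR; module Carrier) renaming (ring to R[1/π])
    open Carrier
    open Hyperelliptic R[1/π]
    open Polynomial R[1/π] using (eval)

    exp-eval : ∀ f x → exp (eval (map (λ c → fromR (ι c)) f) x) ≡ length f ℕ.* exp x
    exp-eval []      x = refl
    exp-eval (c ∷ f) x = cong (exp x ℕ.+_) (exp-eval f x)

    num-eval : ∀ f x →
      num (eval (map (λ c → fromR (ι c)) f) x) R.≈ clearedEval f (num x) (exp x)
    num-eval []      x = R.refl
    num-eval (c ∷ f) x = R.+-cong
      (R.*-congʳ (^-congʳ π (cong (exp x ℕ.+_) (exp-eval f x))))
      (R.trans (R.*-identityˡ _) (R.*-congˡ (num-eval f x)))

    clear-denominators : ∀ {d f n} →
      Σ (Point (fromR (ι d)) (map (λ c → fromR (ι c)) f) n) (λ P → ¬ Trivial P) →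
      ClearedSolution d f
    clear-denominators (infinity _ _ , nontrivial) = contradiction _ nontrivial
    clear-denominators {d} {f} (affine x y (cross e) , _) = num x , exp x , num y , exp y ,
      R.trans (R.*-congʳ (R.sym (^-congʳ π (exp-eval f x))))
        (R.trans e (R.*-congˡ (num-eval f x)))

module _ (p : ℕ) .{{_ : ℕ.NonZero p}} where

  -- d (B / pˡ)² = f (A / pᵏ) with denominators cleared, modulo a power of p just
  -- large enough to survive the cancellation of all powers of p occurring in it.
  record Approximation (f : ℤ[X]) (d B : ℤ) (l : ℕ) (A : ℤ) (k : ℕ) : Set where
    constructor approx
    field
      equation : let e = length f ℕ.* k in
        (+ p) ^ e * (d * (B * B)) ≡ (+ p) ^ (l ℕ.+ l) * homogenize f A ((+ p) ^ k)
          [mod (+ p) ^ (e ℕ.+ suc (l ℕ.+ l)) ]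

  open PAdicIntegers p using (residue; at)
  open import Algebra.Properties.Semiring.Exp (CommutativeRing.semiring (PAdicIntegers.ring p))
    using () renaming (_^_ to _^ₚ_)

  PAdicSolution : ℤ → ℤ[X] → Set
  PAdicSolution = ClearedSolution
    (PAdicIntegers.ring p) (PAdicIntegers.const p (+ p)) (PAdicIntegers.const p)

  residue-^ : ∀ N m → residue (PAdicIntegers.const p (+ p) ^ₚ m) N ≡ (+ p) ^ m
  residue-^ N zero    = refl
  residue-^ N (suc m) = cong ((+ p) *_) (residue-^ N m)

  residue-clearedEval : ∀ f a k N →
    residue (clearedEval (PAdicIntegers.ring p) (PAdicIntegers.const p (+ p))
                         (PAdicIntegers.const p) f a k) N
      ≡ homogenize f (residue a N) ((+ p) ^ k)
  residue-clearedEval []      a k N = refl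
  residue-clearedEval (c ∷ f) a k N = cong₂ (λ u v → u * c + residue a N * v)
    (trans (residue-^ N (suc (length f) ℕ.* k))
      (trans (cong ((+ p) ^_) (ℕ-Prop.*-comm (suc (length f)) k))
             (sym (^-*-assoc (+ p) k (suc (length f))))))
    (residue-clearedEval f a k N)

  approximate : ∀ {d f} → PAdicSolution d f →
    ∃[ B ] ∃[ l ] ∃[ A ] ∃[ k ] Approximation f d B l A k
  approximate {d} {f} (a , k , b , l , e) = B , l , A , k , approx (mod-cast
    (cong (_* (d * (B * B))) (residue-^ N (length f ℕ.* k)))
    (cong₂ _*_ (residue-^ N (l ℕ.+ l)) (residue-clearedEval f a k N))
    refl (at e N))
    where
    N = length f ℕ.* k ℕ.+ suc (l ℕ.+ l)
    A = residue a N
    B = residue b N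

  nontrivial⇒cleared : ∀ {d f n} → HasNontrivialPoint p d f n → PAdicSolution d f
  nontrivial⇒cleared {d} {f} {n} P = clear-denominators (PAdicIntegers.ring p)
    (PAdicIntegers.const p (+ p)) (PAdicIntegers.const p) _ {d} {f} {n} P

  approximate-point : ∀ {d f n} → HasNontrivialPoint p d f n →
    ∃[ B ] ∃[ l ] ∃[ A ] ∃[ k ] Approximation f d B l A k
  approximate-point {d} {f} {n} P = approximate (nontrivial⇒cleared {d} {f} {n} P)

module _ {p : ℕ} (prime : Prime p) where

  private
    instance
      p≢0 : ℕ.NonZero p
      p≢0 = prime⇒nonZero prime

    𝐩 : ℤ
    𝐩 = + p

  prime-∣-* : ∀ a b → 𝐩 ∣ℤ a * b → 𝐩 ∣ℤ a ⊎ 𝐩 ∣ℤ b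
  prime-∣-* a b q
    with euclidsLemma ∣ a ∣ ∣ b ∣ prime (subst (p ∣_) (abs-* a b) (∣⇒∣ᵤ q))
  ... | inj₁ r = inj₁ (∣ᵤ⇒∣ r)
  ... | inj₂ r = inj₂ (∣ᵤ⇒∣ r)

  ℕ-inverse-mod : ∀ a → ¬ p ∣ a → ∃[ b ] + a * b ≡ + 1 [mod 𝐩 ]
  ℕ-inverse-mod a p∤a with coprime-Bézout coprime
    where
    coprime : ∀ {i} → (i ∣ p) × (i ∣ a) → i ≡ 1
    coprime (i∣p , i∣a) with prime⇒irreducible prime i∣p
    ... | inj₁ i≡1 = i≡1
    ... | inj₂ refl = contradiction i∣a p∤a
  ... | Bézout.+- x y eq = - + y , mod-by (divides (- + x) (begin
    + a * - + y + - + 1        ≡⟨ solve 2 (λ a y → a :* :- y :- con (+ 1)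
                                    := :- (con (+ 1) :+ y :* a)) refl (+ a) (+ y) ⟩
    - (+ 1 + + y * + a)        ≡⟨ cong (λ z → - (+ 1 + z)) (pos-* y a) ⟨
    - (+ (1 ℕ.+ y ℕ.* a))      ≡⟨ cong (-_ ∘ +_) eq ⟩
    - (+ (x ℕ.* p))            ≡⟨ cong -_ (pos-* x p) ⟩
    - (+ x * 𝐩)                ≡⟨ ℤ-Prop.neg-distribˡ-* (+ x) 𝐩 ⟩
    - + x * 𝐩                  ∎))
    where open ≡-Reasoning
  ... | Bézout.-+ x y eq = + y , mod-by (divides (+ x) (begin
    + a * + y + - + 1          ≡⟨ cong (_+ - + 1) (*-comm (+ a) (+ y)) ⟩
    + y * + a + - + 1          ≡⟨ cong (_+ - + 1) (pos-* y a) ⟨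
    + (y ℕ.* a) + - + 1        ≡⟨ cong (λ z → + z + - + 1) eq ⟨
    + 1 + + (x ℕ.* p) + - + 1  ≡⟨ cong (λ z → + 1 + z + - + 1) (pos-* x p) ⟩
    + 1 + + x * 𝐩 + - + 1      ≡⟨ solve 1 (λ z → con (+ 1) :+ z :- con (+ 1) := z)
                                    refl (+ x * 𝐩) ⟩
    + x * 𝐩                    ∎))
    where open ≡-Reasoning

  inverse-mod : ∀ a → ¬ 𝐩 ∣ℤ a → ∃[ b ] a * b ≡ + 1 [mod 𝐩 ]
  inverse-mod (+ a) p∤a = ℕ-inverse-mod a (p∤a ∘ ∣ᵤ⇒∣)
  inverse-mod -[1+ a ] p∤a with ℕ-inverse-mod (suc a) (p∤a ∘ ∣ᵤ⇒∣)
  ... | b , e = - b , mod-cast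
    (solve 2 (λ a b → a :* b := :- a :* :- b) refl (+ suc a) b) refl refl e

  ^-cancel-mod : ∀ e {r a b} →
    𝐩 ^ e * a ≡ 𝐩 ^ e * b [mod 𝐩 ^ (e ℕ.+ r) ] → a ≡ b [mod 𝐩 ^ r ]
  ^-cancel-mod zero    {a = a} {b} h = mod-cast (*-identityˡ a) (*-identityˡ b) refl h
  ^-cancel-mod (suc e) {r} {a} {b} (mod-by h) = ^-cancel-mod e {r} (mod-by
    (*-cancelˡ-∣ 𝐩 (subst (𝐩 ^ (suc e ℕ.+ r) ∣ℤ_)
      (solve 4 (λ P Q a b → P :* Q :* a :- P :* Q :* b
                  := P :* (Q :* a :- Q :* b)) refl 𝐩 (𝐩 ^ e) a b) h)))

  p∣p^suc : ∀ e → 𝐩 ∣ℤ 𝐩 ^ suc e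
  p∣p^suc e = divides (𝐩 ^ e) (*-comm 𝐩 (𝐩 ^ e))

  square-descent : ∀ l {d} Y {F} → ¬ 𝐩 ∣ℤ d →
    d * (Y * Y) ≡ 𝐩 ^ (l ℕ.+ l) * F [mod 𝐩 ^ suc (l ℕ.+ l) ] →
    ∃[ Z ] d * (Z * Z) ≡ F [mod 𝐩 ]
  square-descent zero    {d} Y {F} p∤d h =
    Y , mod-cast refl (*-identityˡ F) (ℤ-Prop.^-identityʳ 𝐩) h
  square-descent (suc l) {d} Y {F} p∤d h = descend Y p∣Y h
    where
    p∣dY² : 𝐩 ∣ℤ d * (Y * Y)
    p∣dY² = mod-0⇒∣ (mod-trans (mod-weaken (p∣p^suc (suc l ℕ.+ suc l)) h)
      (∣⇒mod-0 (∣m⇒∣m*n F (p∣p^suc (l ℕ.+ suc l)))))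

    p∣Y : 𝐩 ∣ℤ Y
    p∣Y = [ (λ p∣d → contradiction p∣d p∤d) , ([ id , id ]′ ∘ prime-∣-* Y Y) ]′
      (prime-∣-* d (Y * Y) p∣dY²)

    descend : ∀ Y → 𝐩 ∣ℤ Y →
      d * (Y * Y) ≡ 𝐩 ^ (suc l ℕ.+ suc l) * F [mod 𝐩 ^ suc (suc l ℕ.+ suc l) ] →
      ∃[ Z ] d * (Z * Z) ≡ F [mod 𝐩 ]
    descend _ (divides Z refl) h = square-descent l Z p∤d
      (^-cancel-mod 2 {suc (l ℕ.+ l)} (mod-cast
        (extract-square d Z 𝐩)
        (trans (cong (λ e → 𝐩 ^ suc e * F) (ℕ-Prop.+-suc l l))
          (trans (cong (_* F) (^-distribˡ-+-* 𝐩 2 (l ℕ.+ l)))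
                 (*-assoc (𝐩 ^ 2) (𝐩 ^ (l ℕ.+ l)) F)))
        (cong (λ e → 𝐩 ^ suc (suc e)) (ℕ-Prop.+-suc l l)) h))

  lowest-terms : ∀ {f d B l} j A → Approximation p f d B l A j →
    (∃[ A′ ] Approximation p f d B l A′ 0) ⊎
    (∃[ A′ ] ∃[ j ] ¬ 𝐩 ∣ℤ A′ × Approximation p f d B l A′ (suc j))
  lowest-terms zero    A h = inj₁ (A , h)
  lowest-terms (suc j) A h with 𝐩 ∣? A
  ... | no p∤A = inj₂ (A , j , p∤A , h)
  lowest-terms {f} {d} {B} {l} (suc j) _ (approx h) | yes (divides A refl) =
    lowest-terms j A (approx (^-cancel-mod L {L ℕ.* j ℕ.+ suc (l ℕ.+ l)} (mod-cast
      (trans (cong (_* D) (trans (cong (𝐩 ^_) (ℕ-Prop.*-suc L j))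
                                 (^-distribˡ-+-* 𝐩 L (L ℕ.* j))))
             (*-assoc (𝐩 ^ L) _ D))
      (trans (cong (𝐩 ^ (l ℕ.+ l) *_)
               (trans (cong (λ a → homogenize f a (𝐩 ^ suc j)) (*-comm A 𝐩))
                      (homogenize-scale f 𝐩 A (𝐩 ^ j))))
        (*-swap (𝐩 ^ (l ℕ.+ l)) (𝐩 ^ L) _))
      (cong (𝐩 ^_) (trans (cong (ℕ._+ suc (l ℕ.+ l)) (ℕ-Prop.*-suc L j))
                          (ℕ-Prop.+-assoc L _ _)))
      h)))
    where
    L = length f
    D = d * (B * B)

  affine-approximation : ∀ {f d B l A} → ¬ 𝐩 ∣ℤ d → Approximation p f d B l A 0 →
    ∃[ Y ] d * (Y * Y) ≡ homogenize f A (+ 1) [mod 𝐩 ]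
  affine-approximation {f} {d} {B} {l} p∤d (approx h) = square-descent l B p∤d
    (mod-cast (trans (cong (λ e → 𝐩 ^ e * (d * (B * B))) (ℕ-Prop.*-zeroʳ (length f)))
                     (*-identityˡ _))
      refl (cong (λ e → 𝐩 ^ (e ℕ.+ suc (l ℕ.+ l))) (ℕ-Prop.*-zeroʳ (length f))) h)

  infinite-approximation : ∀ {f d B l A j} q → Degree ℤ-ring f (q ℕ.* 2) →
    ¬ 𝐩 ∣ℤ d → Approximation p f d B l A (suc j) →
    ∃[ Y ] d * (Y * Y) ≡ Polynomial.coeff ℤ-ring f (q ℕ.* 2) * A ^ (q ℕ.* 2) [mod 𝐩 ]
  infinite-approximation {f} {d} {B} {l} {A} {j} q deg p∤d (approx h) =
    conclude (homogenize-leading f (q ℕ.* 2) deg A (𝐩 ^ J))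
    where
    J = suc j
    K = q ℕ.* J ℕ.+ q ℕ.* J
    M = 𝐩 ^ (q ℕ.* J)
    D = d * (B * B)
    S = suc (l ℕ.+ l)
    a = Polynomial.coeff ℤ-ring f (q ℕ.* 2) * A ^ (q ℕ.* 2)

    exponent : ∀ e → length f ≡ e ℕ.+ q ℕ.* 2 → length f ℕ.* J ≡ J ℕ.* e ℕ.+ K
    exponent e L≡ = trans (cong (ℕ._* J) L≡)
      (ℕ-solve 3 (λ e q J → (e ℕ-+ q ℕ-* ℕ-con 2) ℕ-* J
         ℕ-= J ℕ-* e ℕ-+ (q ℕ-* J ℕ-+ q ℕ-* J)) refl e q J)

    reduced : ∀ e F → length f ≡ e ℕ.+ q ℕ.* 2 →
      homogenize f A (𝐩 ^ J) ≡ (𝐩 ^ J) ^ e * F →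
      𝐩 ^ K * D ≡ 𝐩 ^ (l ℕ.+ l) * F [mod 𝐩 ^ (K ℕ.+ S) ]
    reduced e F L≡ H≡ = ^-cancel-mod E {K ℕ.+ S} (mod-cast
      (trans (cong (_* D) (trans (cong (𝐩 ^_) (exponent e L≡)) (^-distribˡ-+-* 𝐩 E K)))
             (*-assoc (𝐩 ^ E) (𝐩 ^ K) D))
      (trans (cong (𝐩 ^ (l ℕ.+ l) *_) (trans H≡ (cong (_* F) (^-*-assoc 𝐩 J e))))
             (*-swap (𝐩 ^ (l ℕ.+ l)) (𝐩 ^ E) F))
      (cong (𝐩 ^_) (trans (cong (ℕ._+ S) (exponent e L≡)) (ℕ-Prop.+-assoc E K S)))
      h)
      where E = J ℕ.* e

    conclude : (∃[ e ] ∃[ t ] length f ≡ e ℕ.+ q ℕ.* 2 ×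
                 homogenize f A (𝐩 ^ J) ≡ (𝐩 ^ J) ^ e * (a + 𝐩 ^ J * t)) →
               ∃[ Y ] d * (Y * Y) ≡ a [mod 𝐩 ]
    conclude (e , t , L≡ , H≡) = square-descent′ (mod-cast
      (trans (cong (_* D) (^-distribˡ-+-* 𝐩 (q ℕ.* J) (q ℕ.* J))) (absorb-square M d B))
      refl refl
      (mod-weaken (divides (𝐩 ^ K) (^-distribˡ-+-* 𝐩 K S))
        (reduced e (a + 𝐩 ^ J * t) L≡ H≡)))
      where
      square-descent′ :
        d * (M * B * (M * B)) ≡ 𝐩 ^ (l ℕ.+ l) * (a + 𝐩 ^ J * t) [mod 𝐩 ^ S ] →
        ∃[ Y ] d * (Y * Y) ≡ a [mod 𝐩 ]
      square-descent′ h = map₂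
        (λ e → mod-trans e (mod-weaken (p∣p^suc j) (mod-+multiple a t)))
        (square-descent l (M * B) p∤d h)

  affine-point : ∀ f n {d s} A Y → s * s ≡ d [mod 𝐩 ] →
    d * (Y * Y) ≡ homogenize f A (+ 1) [mod 𝐩 ] → C⟨𝔽 p ⟩ f n
  affine-point f n {d} {s} A Y s²≡d h = affine A (s * Y)
    (mod-trans (mod-trans (mod-reflexive
        (solve 2 (λ s Y → con (+ 1) :* (s :* Y :* (s :* Y)) := s :* s :* (Y :* Y)) refl s Y))
        (mod-* s²≡d (mod-reflexive {a = Y * Y} refl)))
      (mod-trans h (mod-reflexive (homogenize-1 𝐩 f A))))
    where open Hyperelliptic (𝔽 p)

  infinite-point : ∀ f q {d s} A Y → ¬ 𝐩 ∣ℤ A → s * s ≡ d [mod 𝐩 ] →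
    d * (Y * Y) ≡ Polynomial.coeff ℤ-ring f (q ℕ.* 2) * A ^ (q ℕ.* 2) [mod 𝐩 ] →
    C⟨𝔽 p ⟩ f (q ℕ.* 2)
  infinite-point f q {d} {s} A Y p∤A s²≡d h with inverse-mod A p∤A
  ... | I , AI≡1 = infinity (s * Y * V) (begin
    + 1 * (s * Y * V * (s * Y * V))
      ≡⟨ solve 3 (λ s Y V → con (+ 1) :* (s :* Y :* V :* (s :* Y :* V))
           := s :* s :* (Y :* Y) :* (V :* V)) refl s Y V ⟩
    s * s * (Y * Y) * (V * V)
      ≈⟨ K.*-congʳ {V * V} (K.*-congʳ {Y * Y} s²≡d) ⟩
    d * (Y * Y) * (V * V)
      ≈⟨ K.*-congʳ {V * V} h ⟩
    c * A ^ (q ℕ.* 2) * (V * V)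
      ≡⟨ cong (λ z → c * z * (V * V)) (^-*-assoc A q 2) ⟨
    c * (U * (U * + 1)) * (V * V)
      ≡⟨ solve 3 (λ c U V → c :* (U :* (U :* con (+ 1))) :* (V :* V)
           := c :* (U :* V :* (U :* V))) refl c U V ⟩
    c * (U * V * (U * V))
      ≈⟨ K.*-congˡ {c} (K.*-cong UV≡1 UV≡1) ⟩
    c * + 1
      ≡⟨ ℤ-Prop.*-identityʳ c ⟩
    c
      ≡⟨ coeff-ℤ/ 𝐩 f (q ℕ.* 2) ⟨
    Polynomial.coeff (𝔽 p) f (q ℕ.* 2) ∎)
    where
    module K = CommutativeRing (𝔽 p)
    open Hyperelliptic (𝔽 p)
    open SetoidReasoning K.setoid
    c = Polynomial.coeff ℤ-ring f (q ℕ.* 2)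
    U = A ^ q
    V = I ^ q
    UV≡1 : U * V ≡ + 1 [mod 𝐩 ]
    UV≡1 = mod-cast (^-distribʳ-* A I q) (ℤ-Prop.^-zeroˡ q) refl (mod-^ q AI≡1)

  reduced-point : ∀ {f d s B l A k} q → Degree ℤ-ring f (q ℕ.* 2) →
    ¬ 𝐩 ∣ℤ d → s * s ≡ d [mod 𝐩 ] → Approximation p f d B l A k → C⟨𝔽 p ⟩ f (q ℕ.* 2)
  reduced-point {f} {d} {s} {B} {l} {A} {k} q deg p∤d s²≡d h =
    [ affine-case , infinite-case ]′ (lowest-terms k A h)
    where
    affine-case : (∃[ A′ ] Approximation p f d B l A′ 0) → C⟨𝔽 p ⟩ f (q ℕ.* 2)
    affine-case (A′ , h′) = uncurry
      (λ Y → affine-point f (q ℕ.* 2) {d} {s} A′ Y s²≡d) (affine-approximation p∤d h′)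

    infinite-case : (∃[ A′ ] ∃[ j ] ¬ 𝐩 ∣ℤ A′ × Approximation p f d B l A′ (suc j)) →
                    C⟨𝔽 p ⟩ f (q ℕ.* 2)
    infinite-case (A′ , j , p∤A′ , h′) = uncurry
      (λ Y → infinite-point f q {d} {s} A′ Y p∤A′ s²≡d)
      (infinite-approximation q deg p∤d h′)

lemma4p10 : (f : ℤ[X]) (n : ℕ) → Degree ℤ-ring f n → n ≢ 0 → 2 ∣ n → Separable f →
    (p : ℕ) (good : GoodPrime f p) →
    ¬ C⟨𝔽 p ⟩ f n →
    (d : ℤ) → Squarefree d → NonzeroSquareMod p d →
    ¬ HasNontrivialPoint p {{prime⇒nonZero (GoodPrime.isPrime good)}} d f n
lemma4p10 f _ deg _ (divides q refl) _ p good noPoint d _ (d≢0 , s , s²≡d) P =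
  conclude (approximate-point p {{prime⇒nonZero (GoodPrime.isPrime good)}} {d} {f} {q ℕ.* 2} P)
  where
  conclude : ¬ (∃[ B ] ∃[ l ] ∃[ A ] ∃[ k ]
                Approximation p {{prime⇒nonZero (GoodPrime.isPrime good)}} f d B l A k)
  conclude (B , l , A , k , h) =
    noPoint (reduced-point (GoodPrime.isPrime good) {s = s} q deg (d≢0 ∘ ∣⇒mod-0) s²≡d h)
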